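{- If $A\in\mathcal{PC}_{n}$ is a simple perturbed consistent matrix, then $\mathcal{E}(A)$ is convex.
   Context: An $n$-by-$n$ entrywise positive real matrix $A=[a_{ij}]$ is reciprocal if $a_{ji}=1/a_{ij}$ for all $1\le i,j\le n$ (so diagonal entries are $1$); $\mathcal{PC}_n$ denotes the set of such matrices. A matrix $A\in\mathcal{PC}_n$ is consistent if $a_{ik}=a_{ij}a_{jk}$ for all $i,j,k$. For an entrywise positive vector $w\in\mathbb{R}^n$, $w^{(-T)}$ is the row vector with entries $1/w_j$, so $ww^{(-T)}=[w_i/w_j]$. $A\in\mathcal{PC}_n$ is a simple perturbed consistent matrix if it is a reciprocal matrix obtained from a consistent matrix by changing two entries in symmetrically placed positions, i.e., there are a consistent matrix $C=[c_{ij}]\in\mathcal{PC}_n$ and indices $p\ne q$ such that $a_{ij}=c_{ij}$ for all $(i,j)\notin\{(p,q),(q,p)\}$. A positive vector $w\in\mathbb{R}^n$ is efficient for $A\in\mathcal{PC}_n$ if for every positive vector $v\in\mathbb{R}^n$, the entrywise inequality $|A-vv^{(-T)}|\le |A-ww^{(-T)}|$ (entrywise absolute values) implies that $v$ is proportional to $w$. $\mathcal{E}(A)$ denotes the set of all positive vectors efficient for $A$. -}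

module Defs where

open import Algebra.Apartness.Structures using (IsHeytingField)
open import Algebra.Core using (Op₁; Op₂)
open import Data.Fin.Base using (Fin)
open import Data.Nat.Base using (ℕ)
open import Data.Product.Base using (∃; ∃-syntax; _×_; _,_; proj₁)
open import Data.Sum.Base using (_⊎_; inj₂)
open import Data.Vec.Functional using (Vector)
open import Level as L using (suc)
open import Relation.Binary.Core using (Rel)
open import Relation.Binary.Lattice.Definitions using (Supremum)
open import Relation.Binary.PropositionalEquality.Core using (_≢_)
open import Relation.Binary.Structures using (IsStrictPartialOrder)
open import Relation.Nullary.Negation.Core using (¬_)
open import Relation.Unary using (Pred; _∈_)

-- The real numbers, axiomatised as a Dedekind-complete ordered field.  With
-- excluded middle these are the usual axioms, which determine ℝ up to
-- isomorphism.  Without it, the order is not assumed to be decidable, so binary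
-- maxima are a separate axiom and completeness is restricted to order-located
-- sets (a condition that every set satisfies classically).

record RealNumbers c ℓ : Set (suc (c L.⊔ ℓ)) where
  infix  8 -_
  infixl 7 _*_
  infixl 6 _+_
  infixr 6 _⊔_
  infix  4 _≈_ _<_ _≤_ _#_
  field
    Carrier : Set c
    _≈_     : Rel Carrier ℓ
    _<_     : Rel Carrier ℓ
    _+_     : Op₂ Carrier
    _*_     : Op₂ Carrier
    -_      : Op₁ Carrier
    _⊔_     : Op₂ Carrier
    0#      : Carrier
    1#      : Carrier

  _≤_ : Rel Carrier ℓ
  x ≤ y = ¬ (y < x)

  _#_ : Rel Carrier ℓ
  x # y = x < y ⊎ y < x

  UpperBound : Pred Carrier (c L.⊔ ℓ) → Pred Carrier (c L.⊔ ℓ)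
  UpperBound P b = ∀ x → x ∈ P → x ≤ b

  field
    isHeytingField       : IsHeytingField _≈_ _#_ _+_ _*_ -_ 0# 1#
    isStrictPartialOrder : IsStrictPartialOrder _≈_ _<_
    +-monoˡ-<            : ∀ {x y} z → x < y → x + z < y + z
    *-pos                : ∀ {x y} → 0# < x → 0# < y → 0# < x * y
    ⊔-supremum           : Supremum _≤_ _⊔_
    complete             : (P : Pred Carrier (c L.⊔ ℓ)) →
                           (∃[ x ] x ∈ P) →
                           (∃[ b ] b ∈ UpperBound P) →
                           (∀ {a b} → a < b →
                             (∃[ x ] x ∈ P × a < x) ⊎ b ∈ UpperBound P) →
                           ∃[ s ] s ∈ UpperBound P ×
                             (∀ b → b ∈ UpperBound P → s ≤ b)

  open IsHeytingField isHeytingField public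
    using (_-_; isCommutativeRing; #⇒invertible)

  ∣_∣ : Op₁ Carrier
  ∣ x ∣ = x ⊔ (- x)

  -- #⇒invertible inverts x - 0#, which is ≈ x.
  recip : ∀ {x} → 0# < x → Carrier
  recip 0<x = proj₁ (#⇒invertible (inj₂ 0<x))


module PairwiseComparison {c ℓ} (ℝ : RealNumbers c ℓ) where

  open RealNumbers ℝ

  Matrix : ℕ → Set c
  Matrix n = Vector (Vector Carrier n) n

  Positive : ∀ {n} → Pred (Vector Carrier n) ℓ
  Positive w = ∀ i → 0# < w i

  record PC {n} (A : Matrix n) : Set ℓ where
    field
      positive   : ∀ i j → 0# < A i j
      reciprocal : ∀ i j → A j i ≈ recip (positive i j)

  Consistent : ∀ {n} → Pred (Matrix n) ℓ
  Consistent A = ∀ i j k → A i k ≈ A i j * A j k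

  SimplePerturbedConsistent : ∀ {n} → Pred (Matrix n) (c L.⊔ ℓ)
  SimplePerturbedConsistent {n} A =
    PC A ×
    ∃[ C ] PC C × Consistent C ×
      ∃[ p ] ∃[ q ] p ≢ q ×
        (∀ (i j : Fin n) → (i , j) ≢ (p , q) → (i , j) ≢ (q , p) →
          A i j ≈ C i j)

  -- The matrix w w^(-T).
  ratios : ∀ {n} (w : Vector Carrier n) → Positive w → Matrix n
  ratios w w>0 i j = w i * recip (w>0 j)

  _ProportionalTo_ : ∀ {n} → Rel (Vector Carrier n) (c L.⊔ ℓ)
  v ProportionalTo w = ∃[ r ] (∀ i → v i ≈ r * w i)

  record Efficient {n} (A : Matrix n) (w : Vector Carrier n) : Set (c L.⊔ ℓ) where
    field
      positive  : Positive w
      efficient : ∀ v (v>0 : Positive v) →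
                  (∀ i j → ∣ A i j - ratios v v>0 i j ∣ ≤
                           ∣ A i j - ratios w positive i j ∣) →
                  v ProportionalTo w

  ℰ : ∀ {n} → Matrix n → Pred (Vector Carrier n) (c L.⊔ ℓ)
  ℰ A = Efficient A

  Convex : ∀ {n} → Pred (Vector Carrier n) (c L.⊔ ℓ) → Set (c L.⊔ ℓ)
  Convex S = ∀ {u v} → u ∈ S → v ∈ S →
             ∀ t → 0# ≤ t → t ≤ 1# →
             (λ i → t * u i + (1# - t) * v i) ∈ S

{-# OPTIONS --safe #-}

-- Draw an edge i → j when A i j * w j ≤ w i.  If v is at least as good as w, then
-- v i / w i cannot decrease along an edge, so w is efficient as soon as this graph
-- is strongly connected; and an edge present for two vectors is present for their
-- convex combinations.  So it suffices that any two efficient vectors share a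
-- strongly connected set of edges.  Conversely, for efficient w, edges enter every
-- proper nonempty set of vertices.  If A p q is at least its consistent value
-- C p q, the only edge that can go up in the order of w after C is scaled to the
-- all-ones matrix is q → p, and cutting at the level sets of w then forces all the
-- edges p → i → q → p (for n = 2, the cuts give p → q and q → p directly).  The
-- case A p q ≤ C p q follows by swapping p and q.
--
-- Equality and ≤ of reals are ¬¬-stable, so the case distinctions on the order
-- are made under a double negation.

module Submission where

open import Defs
open import Algebra.Apartness.Structures using (IsHeytingField)
open import Algebra.Bundles using (CommutativeRing)
import Algebra.Properties.Ring as RingProperties
open import Data.Fin.Base using (Fin; zero; suc)
open import Data.Fin.Properties using (_≟_; any?; sequence)
open import Data.Nat.Base using (ℕ)
open import Data.Product.Base using (∃-syntax; _×_; _,_; proj₁; proj₂; uncurry; zip)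
open import Data.Product.Properties using (≡-dec)
open import Data.Sum.Base using (inj₁; inj₂; [_,_]′)
open import Data.Vec.Functional using (Vector)
open import Effect.Monad using (RawMonad)
open import Function.Base using (_∘_)
open import Relation.Binary.Construct.Closure.ReflexiveTransitive
  using (Star; ε; _◅_; _◅◅_; fold; map; return)
open import Relation.Binary.Core using (Rel)
open import Relation.Binary.PropositionalEquality.Core using (_≡_; _≢_; refl; sym)
import Relation.Binary.Reasoning.Base.Triple as Triple
open import Relation.Binary.Structures using (IsPreorder; IsStrictPartialOrder)
open import Relation.Nullary
  using (¬_; Dec; yes; no; ¬?; _×-dec_; contradiction; ¬¬-excluded-middle)
open import Relation.Nullary.Negation using (¬¬-Monad)
open import Relation.Unary using (Pred; Decidable)

-- Arithmetic of an ordered field whose order is not assumed decidable.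

module OrderedField {c ℓ} (ℝ : RealNumbers c ℓ) where

  open RealNumbers ℝ
  open IsHeytingField isHeytingField using (tight; #-cotrans; invertible⇒#)

  commutativeRing : CommutativeRing c ℓ
  commutativeRing = record { isCommutativeRing = isCommutativeRing }

  open CommutativeRing commutativeRing public using
    ( +-comm; +-assoc; +-cong; +-congˡ; +-identityʳ; -‿inverseʳ
    ; *-comm; *-assoc; *-congˡ; *-congʳ; *-identityˡ; *-identityʳ
    ; distribˡ; zeroˡ; zeroʳ )
  open CommutativeRing commutativeRing public using ()
    renaming (refl to ≈-refl; sym to ≈-sym; trans to ≈-trans; isEquivalence to ≈-isEquivalence)
  open RingProperties (CommutativeRing.ring commutativeRing) public
    using (⁻¹-anti-homo‿-; //-rightDividesˡ; x[y-z]≈xy-xz; -0#≈0#; -1*x≈-x; -‿involutive)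

  open IsStrictPartialOrder isStrictPartialOrder public using (<-resp-≈)
    renaming (irrefl to <-irrefl; trans to <-trans; asym to <-asym)

  -- As `≤` is only a negated `<`, the strict conclusion has to come from cotransitivity: `z` is
  -- apart from an end of `x < y`, and two of the four positions are refuted.
  <-≤-trans : ∀ {x y z} → x < y → y ≤ z → x < z
  <-≤-trans {z = z} x<y y≤z with #-cotrans (inj₁ x<y) z
  ... | inj₁ (inj₁ x<z) = x<z
  ... | inj₁ (inj₂ z<x) = contradiction (<-trans z<x x<y) y≤z
  ... | inj₂ (inj₁ z<y) = contradiction z<y y≤z
  ... | inj₂ (inj₂ y<z) = <-trans x<y y<z

  ≤-<-trans : ∀ {x y z} → x ≤ y → y < z → x < z
  ≤-<-trans {x = x} x≤y y<z with #-cotrans (inj₁ y<z) x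
  ... | inj₁ (inj₁ y<x) = contradiction y<x x≤y
  ... | inj₁ (inj₂ x<y) = <-trans x<y y<z
  ... | inj₂ (inj₁ x<z) = x<z
  ... | inj₂ (inj₂ z<x) = contradiction (<-trans y<z z<x) x≤y

  ≤-trans : ∀ {x y z} → x ≤ y → y ≤ z → x ≤ z
  ≤-trans x≤y y≤z z<x = y≤z (<-≤-trans z<x x≤y)

  ≤-reflexive : ∀ {x y} → x ≈ y → x ≤ y
  ≤-reflexive x≈y = <-irrefl (≈-sym x≈y)

  ≤-antisym : ∀ {x y} → x ≤ y → y ≤ x → x ≈ y
  ≤-antisym x≤y y≤x = proj₁ (tight _ _) [ y≤x , x≤y ]′

  -- By tightness `≈` is the negation of `#`, and negations are stable.
  ≈-stable : ∀ {x y} → ¬ ¬ (x ≈ y) → x ≈ y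
  ≈-stable ¬¬x≈y = proj₁ (tight _ _) (λ x#y → ¬¬x≈y (λ x≈y → proj₂ (tight _ _) x≈y x#y))

  ≤-isPreorder : IsPreorder _≈_ _≤_
  ≤-isPreorder = record
    { isEquivalence = ≈-isEquivalence ; reflexive = ≤-reflexive ; trans = ≤-trans }

  module ≤-Reasoning =
    Triple ≤-isPreorder <-asym <-trans <-resp-≈ <-asym <-≤-trans ≤-<-trans
  open ≤-Reasoning

  +-monoˡ-≤ : ∀ {x y} z → x ≤ y → x + z ≤ y + z
  +-monoˡ-≤ {x} {y} z x≤y y+z<x+z = x≤y (begin-strict
    y              ≈⟨ cancel y ⟨
    y + z + - z    <⟨ +-monoˡ-< (- z) y+z<x+z ⟩
    x + z + - z    ≈⟨ cancel x ⟩
    x              ∎)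
    where
    cancel : ∀ w → w + z + - z ≈ w
    cancel w = ≈-trans (+-assoc w z (- z)) (≈-trans (+-congˡ (-‿inverseʳ z)) (+-identityʳ w))

  +-mono-≤ : ∀ {x y u v} → x ≤ y → u ≤ v → x + u ≤ y + v
  +-mono-≤ {x} {y} {u} {v} x≤y u≤v = begin
    x + u  ≤⟨ +-monoˡ-≤ u x≤y ⟩
    y + u  ≈⟨ +-comm y u ⟩
    u + y  ≤⟨ +-monoˡ-≤ y u≤v ⟩
    v + y  ≈⟨ +-comm v y ⟩
    y + v  ∎

  x<y⇒0<y-x : ∀ {x y} → x < y → 0# < y - x
  x<y⇒0<y-x {x} {y} x<y = begin-strict
    0#     ≈⟨ -‿inverseʳ x ⟨
    x - x  <⟨ +-monoˡ-< (- x) x<y ⟩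
    y - x  ∎

  0<y-x⇒x<y : ∀ {x y} → 0# < y - x → x < y
  0<y-x⇒x<y {x} {y} 0<y-x = begin-strict
    x          ≈⟨ +-identityʳ x ⟨
    x + 0#     ≈⟨ +-comm x 0# ⟩
    0# + x     <⟨ +-monoˡ-< x 0<y-x ⟩
    y - x + x  ≈⟨ //-rightDividesˡ x y ⟩
    y          ∎

  x≤y⇒0≤y-x : ∀ {x y} → x ≤ y → 0# ≤ y - x
  x≤y⇒0≤y-x {x} {y} x≤y = begin
    0#     ≈⟨ -‿inverseʳ x ⟨
    x - x  ≤⟨ +-monoˡ-≤ (- x) x≤y ⟩
    y - x  ∎

  -‿antimono-≤ : ∀ {x y} → x ≤ y → - y ≤ - x
  -‿antimono-≤ {x} {y} x≤y -x<-y = x≤y (0<y-x⇒x<y (begin-strict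
    0#         <⟨ x<y⇒0<y-x -x<-y ⟩
    - y - - x  ≈⟨ +-congˡ (-‿involutive x) ⟩
    - y + x    ≈⟨ +-comm (- y) x ⟩
    x - y      ∎))

  *-monoˡ-<-pos : ∀ {x y z} → 0# < z → x < y → z * x < z * y
  *-monoˡ-<-pos {x} {y} {z} 0<z x<y = 0<y-x⇒x<y (begin-strict
    0#             <⟨ *-pos 0<z (x<y⇒0<y-x x<y) ⟩
    z * (y - x)    ≈⟨ x[y-z]≈xy-xz z y x ⟩
    z * y - z * x  ∎)

  x-0≈x : ∀ x → x - 0# ≈ x
  x-0≈x x = ≈-trans (+-congˡ -0#≈0#) (+-identityʳ x)

  -- Signs of units are found this way: apartness from `0#` offers two signs, and the wrong one is
  -- then refuted.
  unit⇒#0 : ∀ {x y} → y * x ≈ 1# → x # 0#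
  unit⇒#0 {x} {y} yx≈1 = invertible⇒# (y , y[x-0]≈1 , ≈-trans (*-comm _ y) y[x-0]≈1)
    where
    y[x-0]≈1 : y * (x - 0#) ≈ 1#
    y[x-0]≈1 = ≈-trans (*-congˡ (x-0≈x x)) yx≈1

  0<1 : 0# < 1#
  0<1 with unit⇒#0 (*-identityˡ 1#)
  ... | inj₂ 0<1 = 0<1
  ... | inj₁ 1<0 = contradiction (*-pos 0<-1 0<-1) λ 0<1′ → <-asym 1<0 (begin-strict
    0#           <⟨ 0<1′ ⟩
    - 1# * - 1#  ≈⟨ -1*x≈-x (- 1#) ⟩
    - - 1#       ≈⟨ -‿involutive 1# ⟩
    1#           ∎)
    where
    0<-1 : 0# < - 1#
    0<-1 = begin-strict
      0#         <⟨ x<y⇒0<y-x 1<0 ⟩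
      0# - 1#    ≈⟨ +-comm 0# (- 1#) ⟩
      - 1# + 0#  ≈⟨ +-identityʳ (- 1#) ⟩
      - 1#       ∎

  1<1+1 : 1# < 1# + 1#
  1<1+1 = begin-strict
    1#       ≈⟨ +-identityʳ 1# ⟨
    1# + 0#  ≈⟨ +-comm 1# 0# ⟩
    0# + 1#  <⟨ +-monoˡ-< 1# 0<1 ⟩
    1# + 1#  ∎

  *-recip : ∀ {x} (0<x : 0# < x) → x * recip 0<x ≈ 1#
  *-recip {x} 0<x =
    ≈-trans (*-congʳ (≈-sym (x-0≈x x))) (proj₂ (proj₂ (#⇒invertible (inj₂ 0<x))))

  recip-* : ∀ {x} (0<x : 0# < x) → recip 0<x * x ≈ 1#
  recip-* 0<x = ≈-trans (*-comm _ _) (*-recip 0<x)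

  cancel-left : ∀ {x y} z → x * y ≈ 1# → x * (y * z) ≈ z
  cancel-left {x} {y} z xy≈1 =
    ≈-trans (≈-sym (*-assoc x y z)) (≈-trans (*-congʳ xy≈1) (*-identityˡ z))

  cancel-right : ∀ {y z} x → y * z ≈ 1# → (x * y) * z ≈ x
  cancel-right {y} {z} x yz≈1 =
    ≈-trans (*-assoc x y z) (≈-trans (*-congˡ yz≈1) (*-identityʳ x))

  cancel-middle : ∀ {x y} w z → x * y ≈ 1# → (w * x) * (y * z) ≈ w * z
  cancel-middle w z xy≈1 = ≈-trans (*-assoc w _ _) (*-congˡ (cancel-left z xy≈1))

  recip-pos : ∀ {x} (0<x : 0# < x) → 0# < recip 0<x
  recip-pos {x} 0<x with unit⇒#0 (*-recip 0<x)
  ... | inj₂ 0<r = 0<r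
  ... | inj₁ r<0 = contradiction (begin-strict
    1#             ≈⟨ *-recip 0<x ⟨
    x * recip 0<x  <⟨ *-monoˡ-<-pos 0<x r<0 ⟩
    x * 0#         ≈⟨ zeroʳ x ⟩
    0#             ∎) (<-asym 0<1)

  *-cancelˡ-<-pos : ∀ {x y z} → 0# < z → z * x < z * y → x < y
  *-cancelˡ-<-pos {x} {y} {z} 0<z zx<zy = begin-strict
    x                     ≈⟨ cancel-left x (recip-* 0<z) ⟨
    recip 0<z * (z * x)   <⟨ *-monoˡ-<-pos (recip-pos 0<z) zx<zy ⟩
    recip 0<z * (z * y)   ≈⟨ cancel-left y (recip-* 0<z) ⟩
    y                     ∎

  *-monoˡ-≤-pos : ∀ {x y z} → 0# < z → x ≤ y → z * x ≤ z * y
  *-monoˡ-≤-pos 0<z x≤y zy<zx = x≤y (*-cancelˡ-<-pos 0<z zy<zx)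

  *-monoʳ-≤-pos : ∀ {x y z} → 0# < z → x ≤ y → x * z ≤ y * z
  *-monoʳ-≤-pos {x} {y} {z} 0<z x≤y = begin
    x * z  ≈⟨ *-comm x z ⟩
    z * x  ≤⟨ *-monoˡ-≤-pos 0<z x≤y ⟩
    z * y  ≈⟨ *-comm z y ⟩
    y * z  ∎

  -- There is no case split on `z`. If the conclusion failed, `0# < z` would be impossible, so
  -- `z ≈ 0#` and both products would vanish.
  *-monoˡ-≤-nonNeg : ∀ {x y z} → 0# ≤ z → x ≤ y → z * x ≤ z * y
  *-monoˡ-≤-nonNeg {x} {y} {z} 0≤z x≤y zy<zx = <-irrefl zy≈zx zy<zx
    where
    0≈z : 0# ≈ z
    0≈z = ≤-antisym 0≤z (λ 0<z → *-monoˡ-≤-pos 0<z x≤y zy<zx)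

    zy≈zx : z * y ≈ z * x
    zy≈zx = ≈-trans (*-congʳ (≈-sym 0≈z)) (≈-trans (zeroˡ y)
              (≈-trans (≈-sym (zeroˡ x)) (*-congʳ 0≈z)))

  *-cancelˡ-≈-pos : ∀ {x y z} → 0# < z → z * x ≈ z * y → x ≈ y
  *-cancelˡ-≈-pos 0<z zx≈zy = ≤-antisym
    (λ y<x → <-irrefl (≈-sym zx≈zy) (*-monoˡ-<-pos 0<z y<x))
    (λ x<y → <-irrefl zx≈zy (*-monoˡ-<-pos 0<z x<y))

  *≤⇒≤/ : ∀ {x y z} (0<y : 0# < y) → z * y ≤ x → z ≤ x * recip 0<y
  *≤⇒≤/ {x} {y} {z} 0<y zy≤x = begin
    z                  ≈⟨ cancel-right z (*-recip 0<y) ⟨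
    z * y * recip 0<y  ≤⟨ *-monoʳ-≤-pos (recip-pos 0<y) zy≤x ⟩
    x * recip 0<y      ∎

  ≤*⇒/≤ : ∀ {x y z} (0<y : 0# < y) → x ≤ z * y → x * recip 0<y ≤ z
  ≤*⇒/≤ {x} {y} {z} 0<y x≤zy = begin
    x * recip 0<y      ≤⟨ *-monoʳ-≤-pos (recip-pos 0<y) x≤zy ⟩
    z * y * recip 0<y  ≈⟨ cancel-right z (*-recip 0<y) ⟩
    z                  ∎

  -- Cotransitivity of `0# < 1#` at `t` yields `0# < t` or `t < 1#`, so one summand is strictly
  -- positive while the other is nonnegative.
  convex-pos : ∀ {x y t} → 0# < x → 0# < y → 0# ≤ t → t ≤ 1# → 0# < t * x + (1# - t) * y
  convex-pos {x} {y} {t} 0<x 0<y 0≤t t≤1 with #-cotrans (inj₁ 0<1) t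
  ... | inj₁ (inj₂ t<0) = contradiction t<0 0≤t
  ... | inj₂ (inj₂ 1<t) = contradiction 1<t t≤1
  ... | inj₁ (inj₁ 0<t) = begin-strict
    0#                     <⟨ *-pos 0<t 0<x ⟩
    t * x                  ≈⟨ +-identityʳ (t * x) ⟨
    t * x + 0#             ≤⟨ +-mono-≤ (≤-reflexive ≈-refl) (begin
      0#              ≈⟨ zeroʳ (1# - t) ⟨
      (1# - t) * 0#   ≤⟨ *-monoˡ-≤-nonNeg (x≤y⇒0≤y-x t≤1) (<-asym 0<y) ⟩
      (1# - t) * y    ∎) ⟩
    t * x + (1# - t) * y   ∎
  ... | inj₂ (inj₁ t<1) = begin-strict
    0#                     <⟨ *-pos (x<y⇒0<y-x t<1) 0<y ⟩
    (1# - t) * y           ≈⟨ +-identityʳ ((1# - t) * y) ⟨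
    (1# - t) * y + 0#      ≈⟨ +-comm ((1# - t) * y) 0# ⟩
    0# + (1# - t) * y      ≤⟨ +-monoˡ-≤ ((1# - t) * y) (begin
      0#      ≈⟨ zeroʳ t ⟨
      t * 0#  ≤⟨ *-monoˡ-≤-nonNeg 0≤t (<-asym 0<x) ⟩
      t * x   ∎) ⟩
    t * x + (1# - t) * y   ∎

  -- Absolute values and distance to a target.

  x≤∣x∣ : ∀ x → x ≤ ∣ x ∣
  x≤∣x∣ x = proj₁ (⊔-supremum x (- x))

  -x≤∣x∣ : ∀ x → - x ≤ ∣ x ∣
  -x≤∣x∣ x = proj₁ (proj₂ (⊔-supremum x (- x)))

  ∣x-y∣-least : ∀ {x y z} → x - y ≤ z → y - x ≤ z → ∣ x - y ∣ ≤ z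
  ∣x-y∣-least {x} {y} x-y≤z y-x≤z = proj₂ (proj₂ (⊔-supremum (x - y) (- (x - y)))) _
    x-y≤z (≤-trans (≤-reflexive (⁻¹-anti-homo‿- x y)) y-x≤z)

  x-y≤∣x-y∣ : ∀ x y → x - y ≤ ∣ x - y ∣
  x-y≤∣x-y∣ x y = x≤∣x∣ (x - y)

  y-x≤∣x-y∣ : ∀ x y → y - x ≤ ∣ x - y ∣
  y-x≤∣x-y∣ x y = ≤-trans (≤-reflexive (≈-sym (⁻¹-anti-homo‿- x y))) (-x≤∣x∣ (x - y))

  -‿mono-≤ : ∀ {x y u v} → x ≤ y → u ≤ v → x - v ≤ y - u
  -‿mono-≤ x≤y u≤v = +-mono-≤ x≤y (-‿antimono-≤ u≤v)

  x≤y⇒x-y≤y-x : ∀ {x y} → x ≤ y → x - y ≤ y - x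
  x≤y⇒x-y≤y-x x≤y = -‿mono-≤ x≤y x≤y

  closer-from-below : ∀ {a x y} → x ≤ y → y ≤ a → ∣ a - y ∣ ≤ ∣ a - x ∣
  closer-from-below {a} {x} {y} x≤y y≤a = ≤-trans (∣x-y∣-least
    (-‿mono-≤ (≤-reflexive ≈-refl) x≤y) (-‿mono-≤ y≤a (≤-trans x≤y y≤a)))
    (x-y≤∣x-y∣ a x)

  closer-from-above : ∀ {a x y} → a ≤ y → y ≤ x → ∣ a - y ∣ ≤ ∣ a - x ∣
  closer-from-above {a} {x} {y} a≤y y≤x = ≤-trans (∣x-y∣-least
    (-‿mono-≤ (≤-trans a≤y y≤x) a≤y) (-‿mono-≤ y≤x (≤-reflexive ≈-refl)))
    (y-x≤∣x-y∣ a x)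

  closer⇒≤ : ∀ {a x y} → a ≤ x → ∣ a - y ∣ ≤ ∣ a - x ∣ → y ≤ x
  closer⇒≤ {a} {x} {y} a≤x closer = begin
    y          ≈⟨ //-rightDividesˡ a y ⟨
    y - a + a  ≤⟨ +-monoˡ-≤ a (begin
      y - a      ≤⟨ y-x≤∣x-y∣ a y ⟩
      ∣ a - y ∣  ≤⟨ closer ⟩
      ∣ a - x ∣  ≤⟨ ∣x-y∣-least (x≤y⇒x-y≤y-x a≤x) (≤-reflexive ≈-refl) ⟩
      x - a      ∎) ⟩
    x - a + a  ≈⟨ //-rightDividesˡ a x ⟩
    x          ∎

  -- By downward closure the smallest of the factors serves for every `Q i`; it is selected by
  -- comparisons under a double negation.
  commonFactor : ∀ {a m} (Q : Fin m → Pred Carrier a) →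
                 (∀ i {x y} → x ≤ y → Q i y → Q i x) →
                 (∀ i → ¬ ¬ (∃[ s ] 1# < s × Q i s)) →
                 ¬ ¬ (∃[ s ] 1# < s × (∀ i → Q i s))
  commonFactor {m = ℕ.zero}  Q down factors none = none (1# + 1# , 1<1+1 , λ ())
  commonFactor {m = ℕ.suc m} Q down factors none =
    factors zero λ (s , 1<s , Qs) →
    commonFactor (Q ∘ suc) (down ∘ suc) (factors ∘ suc) λ (t , 1<t , Qt) →
    ¬¬-excluded-middle λ where
      (yes s<t) → none (s , 1<s , λ { zero → Qs ; (suc i) → down (suc i) (<-asym s<t) (Qt i) })
      (no t≤s)  → none (t , 1<t , λ { zero → down zero t≤s Qs ; (suc i) → Qt i })


-- Strong connectivity of directed graphs.

module _ {n g} {G : Rel (Fin n) g} {p q : Fin n} where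

  -- The cycles `p → i → q → p` all pass through `p`. The third vertex `k` supplies the path from
  -- `p` to `q`.
  cycle-through⇒connected :
    (∃[ k ] k ≢ p × k ≢ q) → G q p → (∀ i → i ≢ p → i ≢ q → G p i × G i q) →
    ∀ i j → Star G i j
  cycle-through⇒connected (k , k≢p , k≢q) qp through i j = to-p i ◅◅ from-p j
    where
    to-p : ∀ i → Star G i p
    to-p i with i ≟ p | i ≟ q
    ... | yes refl | _        = ε
    ... | no _     | yes refl = return qp
    ... | no i≢p   | no i≢q   = proj₂ (through i i≢p i≢q) ◅ return qp

    from-p : ∀ i → Star G p i
    from-p i with i ≟ p | i ≟ q
    ... | yes refl | _        = ε
    ... | no _     | yes refl = uncurry (λ pk kq → pk ◅ return kq) (through k k≢p k≢q)
    ... | no i≢p   | no i≢q   = return (proj₁ (through i i≢p i≢q))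

  two-cycle⇒connected :
    ¬ (∃[ k ] k ≢ p × k ≢ q) → G p q → G q p → ∀ i j → Star G i j
  two-cycle⇒connected only pq qp i j = to-p i ◅◅ from-p j
    where
    to-p : ∀ i → Star G i p
    to-p i with i ≟ p | i ≟ q
    ... | yes refl | _        = ε
    ... | no _     | yes refl = return qp
    ... | no i≢p   | no i≢q   = contradiction (i , i≢p , i≢q) only

    from-p : ∀ i → Star G p i
    from-p i with i ≟ p | i ≟ q
    ... | yes refl | _        = ε
    ... | no _     | yes refl = return pq
    ... | no i≢p   | no i≢q   = contradiction (i , i≢p , i≢q) only


-- The graph of a vector, and efficiency from strong connectivity.

module _ {c ℓ} (ℝ : RealNumbers c ℓ) where

  open RealNumbers ℝ
  open PairwiseComparison ℝ
  open OrderedField ℝ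
  open ≤-Reasoning

  Edge : ∀ {n} → Matrix n → Vector Carrier n → Rel (Fin n) ℓ
  Edge A w i j = A i j * w j ≤ w i

  PC-inverse : ∀ {n} {A : Matrix n} → PC A → ∀ i j → A i j * A j i ≈ 1#
  PC-inverse pc i j =
    ≈-trans (*-congˡ (PC.reciprocal pc i j)) (*-recip (PC.positive pc i j))

  PC-antitone : ∀ {n} {A B : Matrix n} → PC A → PC B →
                ∀ {i j} → A i j ≤ B i j → B j i ≤ A j i
  PC-antitone {A = A} {B} pcA pcB {i} {j} Aij≤Bij Aji<Bji = <-irrefl ≈-refl (begin-strict
    1#               ≈⟨ PC-inverse pcA i j ⟨
    A i j * A j i    <⟨ *-monoˡ-<-pos (PC.positive pcA i j) Aji<Bji ⟩
    A i j * B j i    ≤⟨ *-monoʳ-≤-pos (PC.positive pcB j i) Aij≤Bij ⟩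
    B i j * B j i    ≈⟨ PC-inverse pcB i j ⟩
    1#               ∎)

  -- The edge inequality is linear in the weights.
  Edge-convex : ∀ {n} {A : Matrix n} {u v : Vector Carrier n} {t} → 0# ≤ t → t ≤ 1# →
                ∀ {i j} → Edge A u i j × Edge A v i j →
                Edge A (λ k → t * u k + (1# - t) * v k) i j
  Edge-convex {A = A} {u} {v} {t} 0≤t t≤1 {i} {j} (uᵢⱼ , vᵢⱼ) = begin
    A i j * (t * u j + (1# - t) * v j)              ≈⟨ distribˡ _ _ _ ⟩
    A i j * (t * u j) + A i j * ((1# - t) * v j)    ≈⟨ +-cong (swap _ _ _) (swap _ _ _) ⟩
    t * (A i j * u j) + (1# - t) * (A i j * v j)    ≤⟨ +-mono-≤ (*-monoˡ-≤-nonNeg 0≤t uᵢⱼ)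
                                                         (*-monoˡ-≤-nonNeg (x≤y⇒0≤y-x t≤1) vᵢⱼ) ⟩
    t * u i + (1# - t) * v i                        ∎
    where
    swap : ∀ x y z → x * (y * z) ≈ y * (x * z)
    swap x y z = ≈-trans (≈-sym (*-assoc x y z)) (≈-trans (*-congʳ (*-comm x y)) (*-assoc y x z))

  -- Along an edge i → j the ratio w i / w j overshoots A i j, so a v that is at
  -- least as good as w at (i , j) cannot have a larger ratio there.
  Edge⇒quotient-≤ : ∀ {n} {A : Matrix n} {w v : Vector Carrier n}
                    (w>0 : Positive w) (v>0 : Positive v) →
                    (∀ i j → ∣ A i j - ratios v v>0 i j ∣ ≤ ∣ A i j - ratios w w>0 i j ∣) →
                    ∀ {i j} → Edge A w i j → v i * recip (w>0 i) ≤ v j * recip (w>0 j)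
  Edge⇒quotient-≤ {A = A} {w} {v} w>0 v>0 closer {i} {j} edge = begin
    v i * recip (w>0 i)
      ≈⟨ cancel-middle (v i) (recip (w>0 i)) (recip-* (v>0 j)) ⟨
    v i * recip (v>0 j) * (v j * recip (w>0 i))
      ≤⟨ *-monoʳ-≤-pos (*-pos (v>0 j) (recip-pos (w>0 i)))
           (closer⇒≤ (*≤⇒≤/ (w>0 j) edge) (closer i j)) ⟩
    w i * recip (w>0 j) * (v j * recip (w>0 i))
      ≈⟨ *-comm _ _ ⟩
    v j * recip (w>0 i) * (w i * recip (w>0 j))
      ≈⟨ cancel-middle (v j) (recip (w>0 j)) (recip-* (w>0 i)) ⟩
    v j * recip (w>0 j)  ∎

  -- Paths in both directions make the quotient `v i / w i` constant, and its value at `p` is the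
  -- proportionality factor. Stability of `≈` lets connectivity be given under a double negation.
  connected⇒efficient : ∀ {n} {A : Matrix n} {w : Vector Carrier n} → Fin n → Positive w →
                        ¬ ¬ (∀ i j → Star (Edge A w) i j) → Efficient A w
  connected⇒efficient {A = A} {w} p w>0 connected = record
    { positive  = w>0
    ; efficient = λ v v>0 closer →
        let
          quotient-≤ : ∀ {i j} → Star (Edge A w) i j → v i * recip (w>0 i) ≤ v j * recip (w>0 j)
          quotient-≤ = fold (λ i j → v i * recip (w>0 i) ≤ v j * recip (w>0 j))
            (≤-trans ∘ Edge⇒quotient-≤ {A = A} w>0 v>0 closer) (≤-reflexive ≈-refl)
        in
        v p * recip (w>0 p) , λ i → ≈-stable λ v≉rw → connected λ path → v≉rw
          (≈-trans (≈-sym (cancel-right (v i) (recip-* (w>0 i))))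
            (*-congʳ (≤-antisym (quotient-≤ (path i p)) (quotient-≤ (path p i)))))
    }

  -- Edges forced by efficiency.

  module _ {n} {A : Matrix n} (pcA : PC A) {w : Vector Carrier n} (w∈ℰ : Efficient A w) where

    open Efficient w∈ℰ using (efficient) renaming (positive to w>0)

    -- Otherwise the weights outside T could be scaled up by a common factor
    -- s > 1 without any ratio overshooting its target.
    ¬no-edge-into : ∀ {a} {T : Pred (Fin n) a} → Decidable T →
                    ∀ {i j} → ¬ T i → T j →
                    ¬ (∀ k l → ¬ T k → T l → ¬ Edge A w k l)
    ¬no-edge-into {T = T} T? {i₀} {j₀} ¬Ti₀ Tj₀ no-edge = commonFactor Row row-down row contra
      where
      Entry : Fin n → Fin n → Pred Carrier _
      Entry k l s = ¬ T k → T l → w k * s ≤ A k l * w l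

      Row : Fin n → Pred Carrier _
      Row k s = ∀ l → Entry k l s

      row-down : ∀ k {x y} → x ≤ y → Row k y → Row k x
      row-down k x≤y row l ¬Tk Tl = ≤-trans (*-monoˡ-≤-pos (w>0 k) x≤y) (row l ¬Tk Tl)

      entry : ∀ k l → ¬ ¬ (∃[ s ] 1# < s × Entry k l s)
      entry k l none with T? k | T? l
      ... | yes Tk | _      = none (1# + 1# , 1<1+1 , λ ¬Tk → contradiction Tk ¬Tk)
      ... | no _   | no ¬Tl = none (1# + 1# , 1<1+1 , λ _ Tl → contradiction Tl ¬Tl)
      ... | no ¬Tk | yes Tl = no-edge k l ¬Tk Tl λ wₖ<Awₗ →
        -- The factor `A k l * w l / w k` brings the ratio exactly to its target; it exceeds `1#`
        -- because the edge is absent.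
        none (recip (w>0 k) * (A k l * w l) , *-cancelˡ-<-pos (w>0 k) (begin-strict
          w k * 1#                                ≈⟨ *-identityʳ (w k) ⟩
          w k                                     <⟨ wₖ<Awₗ ⟩
          A k l * w l                             ≈⟨ cancel-left _ (*-recip (w>0 k)) ⟨
          w k * (recip (w>0 k) * (A k l * w l))   ∎)
        , λ _ _ → ≤-reflexive (cancel-left _ (*-recip (w>0 k))))

      row : ∀ k → ¬ ¬ (∃[ s ] 1# < s × Row k s)
      row k = commonFactor (Entry k)
        (λ l x≤y e ¬Tk Tl → ≤-trans (*-monoˡ-≤-pos (w>0 k) x≤y) (e ¬Tk Tl)) (entry k)

      contra : ¬ (∃[ s ] 1# < s × (∀ k → Row k s))
      contra (s , 1<s , bound) = <-irrefl 1≈s 1<s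
        where
        scale : ∀ {k} → Dec (T k) → Carrier
        scale (yes _) = 1#
        scale (no _)  = s

        scale>0 : ∀ {k} (d : Dec (T k)) → 0# < scale d
        scale>0 (yes _) = 0<1
        scale>0 (no _)  = <-trans 0<1 1<s

        σ v : Vector Carrier n
        σ k = scale (T? k)
        v k = w k * σ k

        v>0 : Positive v
        v>0 k = *-pos (w>0 k) (scale>0 (T? k))

        -- Multiplied by `v l`, the ratio of `w` becomes `w k * σ l` and that of `v` becomes
        -- `w k * σ k`, so comparing ratios reduces to comparing scalings.
        target : ∀ k l → ratios w w>0 k l * v l ≈ w k * σ l
        target k l = cancel-middle (w k) (σ l) (recip-* (w>0 l))

        ratio-≤ : ∀ {k l} → σ l ≤ σ k → ratios w w>0 k l ≤ ratios v v>0 k l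
        ratio-≤ {k} {l} σₗ≤σₖ = *≤⇒≤/ (v>0 l)
          (≤-trans (≤-reflexive (target k l)) (*-monoˡ-≤-pos (w>0 k) σₗ≤σₖ))

        ratio-≥ : ∀ {k l} → σ k ≤ σ l → ratios v v>0 k l ≤ ratios w w>0 k l
        ratio-≥ {k} {l} σₖ≤σₗ = ≤*⇒/≤ (v>0 l)
          (≤-trans (*-monoˡ-≤-pos (w>0 k) σₖ≤σₗ) (≤-reflexive (≈-sym (target k l))))

        ratio-≈ : ∀ {k l} → σ k ≈ σ l → ∣ A k l - ratios v v>0 k l ∣ ≤ ∣ A k l - ratios w w>0 k l ∣
        ratio-≈ {k} {l} σₖ≈σₗ = ∣x-y∣-least
          (≤-trans (-‿mono-≤ (≤-reflexive ≈-refl) (ratio-≤ (≤-reflexive (≈-sym σₖ≈σₗ)))) (x-y≤∣x-y∣ _ _))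
          (≤-trans (-‿mono-≤ (ratio-≥ (≤-reflexive σₖ≈σₗ)) (≤-reflexive ≈-refl)) (y-x≤∣x-y∣ _ _))

        σ-inside : ∀ {k} → T k → σ k ≈ 1#
        σ-inside {k} Tk with T? k
        ... | yes _  = ≈-refl
        ... | no ¬Tk = contradiction Tk ¬Tk

        σ-outside : ∀ {k} → ¬ T k → σ k ≈ s
        σ-outside {k} ¬Tk with T? k
        ... | yes Tk = contradiction Tk ¬Tk
        ... | no _   = ≈-refl

        inside≤outside : ∀ {k l} → T k → ¬ T l → σ k ≤ σ l
        inside≤outside {k} {l} Tk ¬Tl = begin
          σ k  ≈⟨ σ-inside Tk ⟩
          1#   <⟨ 1<s ⟩
          s    ≈⟨ σ-outside ¬Tl ⟨
          σ l  ∎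

        scaled : ∀ {k l} → ¬ T k → T l → v k ≤ A k l * v l
        scaled {k} {l} ¬Tk Tl = begin
          w k * σ k            ≈⟨ *-congˡ (σ-outside ¬Tk) ⟩
          w k * s              ≤⟨ bound k l ¬Tk Tl ⟩
          A k l * w l          ≈⟨ *-congˡ (*-identityʳ (w l)) ⟨
          A k l * (w l * 1#)   ≈⟨ *-congˡ (*-congˡ (σ-inside Tl)) ⟨
          A k l * (w l * σ l)  ∎

        scaled⁻¹ : ∀ {k l} → T k → ¬ T l → A k l * v l ≤ v k
        scaled⁻¹ {k} {l} Tk ¬Tl = begin
          A k l * v l            ≤⟨ *-monoˡ-≤-pos (PC.positive pcA k l) (scaled ¬Tl Tk) ⟩
          A k l * (A l k * v k)  ≈⟨ cancel-left (v k) (PC-inverse pcA k l) ⟩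
          v k                    ∎

        -- Ratios within `T` and within its complement do not change; those across the cut move
        -- towards their targets without passing them.
        closer : ∀ k l → ∣ A k l - ratios v v>0 k l ∣ ≤ ∣ A k l - ratios w w>0 k l ∣
        closer k l = by-cases (T? k) (T? l)
          where
          by-cases : Dec (T k) → Dec (T l) →
                     ∣ A k l - ratios v v>0 k l ∣ ≤ ∣ A k l - ratios w w>0 k l ∣
          by-cases (yes Tk) (yes Tl) = ratio-≈ (≈-trans (σ-inside Tk) (≈-sym (σ-inside Tl)))
          by-cases (no ¬Tk) (no ¬Tl) = ratio-≈ (≈-trans (σ-outside ¬Tk) (≈-sym (σ-outside ¬Tl)))
          by-cases (yes Tk) (no ¬Tl) = closer-from-above
            (*≤⇒≤/ (v>0 l) (scaled⁻¹ Tk ¬Tl)) (ratio-≥ (inside≤outside Tk ¬Tl))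
          by-cases (no ¬Tk) (yes Tl) = closer-from-below
            (ratio-≤ (inside≤outside Tl ¬Tk)) (≤*⇒/≤ (v>0 l) (scaled ¬Tk Tl))

        proportional : v ProportionalTo w
        proportional = efficient v v>0 closer

        σ≈r : ∀ k → σ k ≈ proj₁ proportional
        σ≈r k = *-cancelˡ-≈-pos (w>0 k) (≈-trans (proj₂ proportional k) (*-comm _ (w k)))

        -- Proportionality makes `σ` constant, yet it is `1#` at `j₀` and `s` at `i₀`.
        1≈s : 1# ≈ s
        1≈s = ≈-trans (≈-sym (σ-inside Tj₀))
          (≈-trans (σ≈r j₀) (≈-trans (≈-sym (σ≈r i₀)) (σ-outside ¬Ti₀)))

    -- Cut around the single vertex `q`: only `p` lies outside, so only `p → q` can enter.
    efficient⇒edge : ∀ {p q} → p ≢ q → ¬ (∃[ k ] k ≢ p × k ≢ q) → Edge A w p q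
    efficient⇒edge {p} {q} p≢q only wₚ<Aw_q = ¬no-edge-into (_≟ q) p≢q refl no-edge
      where
      no-edge : ∀ k l → k ≢ q → l ≡ q → ¬ Edge A w k l
      no-edge k l k≢q refl edge with k ≟ p
      ... | yes refl = edge wₚ<Aw_q
      ... | no k≢p   = only (k , k≢p , k≢q)

    -- Level sets of the weights scaled by the consistent matrix.

    module _ {C : Matrix n} (pcC : PC C) (consistent : Consistent C)
             {p q : Fin n} (p≢q : p ≢ q)
             (A≈C : ∀ i j → (i , j) ≢ (p , q) → (i , j) ≢ (q , p) → A i j ≈ C i j)
             (C≤A : C p q ≤ A p q) where

      A≤C : A q p ≤ C q p
      A≤C = PC-antitone pcC pcA C≤A

      -- With C i j = d i / d j, this says that w i / d i < w j / d j.
      infix 4 _≺_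
      _≺_ : Rel (Fin n) ℓ
      i ≺ j = w i < C i j * w j

      C-cancel : ∀ i j x → C i j * (C j i * x) ≈ x
      C-cancel i j x = cancel-left x (PC-inverse pcC i j)

      ≺-irrefl : ∀ i → ¬ i ≺ i
      ≺-irrefl i = ≤-reflexive (begin-equality
        C i i * w i              ≈⟨ *-congʳ (consistent i i i) ⟩
        C i i * C i i * w i      ≈⟨ *-assoc _ _ _ ⟩
        C i i * (C i i * w i)    ≈⟨ C-cancel i i (w i) ⟩
        w i                      ∎)

      -- In scaled weights `k` is at most `i`, and `i` is below `l`. Multiplying by `C k i` rebases
      -- both comparisons at `k`, by consistency.
      ⊀-≺-trans : ∀ {i k l} → ¬ i ≺ k → i ≺ l → k ≺ l
      ⊀-≺-trans {i} {k} {l} i⊀k i≺l = begin-strict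
        w k                    ≈⟨ C-cancel k i (w k) ⟨
        C k i * (C i k * w k)  ≤⟨ *-monoˡ-≤-pos (PC.positive pcC k i) i⊀k ⟩
        C k i * w i            <⟨ *-monoˡ-<-pos (PC.positive pcC k i) i≺l ⟩
        C k i * (C i l * w l)  ≈⟨ *-assoc _ _ _ ⟨
        C k i * C i l * w l    ≈⟨ *-congʳ (consistent k i l) ⟨
        C k l * w l            ∎

      -- Every edge except q → p goes from a weight to one that is not ≺-larger.
      -- Hence only q → p can enter an upper set of ≺.
      only-edge-into : ∀ {i j} → i ≺ j → ¬ (¬ i ≺ q → i ≺ p → ¬ Edge A w q p)
      only-edge-into {i} {j} i≺j no-edge-qp =
        -- The cut must be decidable but `≺` is not; the finitely many decisions are collected under
        -- a double negation.
        sequence (RawMonad.rawApplicative ¬¬-Monad) (λ k → ¬¬-excluded-middle {A = i ≺ k})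
          λ i≺? → ¬no-edge-into i≺? (≺-irrefl i) i≺j no-edge
        where
        no-edge : ∀ k l → ¬ i ≺ k → i ≺ l → ¬ Edge A w k l
        no-edge k l i⊀k i≺l edge
          with ≡-dec _≟_ _≟_ (k , l) (p , q) | ≡-dec _≟_ _≟_ (k , l) (q , p)
        ... | _        | yes refl = no-edge-qp i⊀k i≺l edge
        ... | yes refl | no _     =
          -- As `C p q ≤ A p q`, the edge `p → q` persists with `C` in place of `A`, contradicting
          -- `p ≺ q`.
          ≤-trans (*-monoʳ-≤-pos (w>0 q) C≤A) edge (⊀-≺-trans i⊀k i≺l)
        ... | no kl≢pq | no kl≢qp =
          ≤-trans (≤-reflexive (*-congʳ (≈-sym (A≈C k l kl≢pq kl≢qp)))) edge (⊀-≺-trans i⊀k i≺l)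

      -- If the edge were absent, `A q p ≤ C q p` would give `q ≺ p`, and nothing could enter the
      -- level set above `q`.
      efficient⇒edge-qp : Edge A w q p
      efficient⇒edge-qp w_q<Awₚ =
        only-edge-into (<-≤-trans w_q<Awₚ (*-monoʳ-≤-pos (w>0 p) A≤C)) λ _ _ edge → edge w_q<Awₚ

      -- Away from the perturbed positions an edge means `⊀`. If `p ≺ i`, the level set above `p`
      -- omits `p`; if `i ≺ q`, the one above `i` already contains `q`. Either way `q → p` does not
      -- enter it.
      efficient⇒edges-through : ∀ i → i ≢ p → i ≢ q → Edge A w p i × Edge A w i q
      efficient⇒edges-through i i≢p i≢q =
        ≤-trans (≤-reflexive (*-congʳ (A≈C p i (λ { refl → i≢q refl }) (λ { refl → p≢q refl })))) p⊀i ,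
        ≤-trans (≤-reflexive (*-congʳ (A≈C i q (λ { refl → i≢p refl }) (λ { refl → i≢q refl })))) i⊀q
        where
        p⊀i : ¬ p ≺ i
        p⊀i p≺i = only-edge-into p≺i λ _ p≺p _ → ≺-irrefl p p≺p

        i⊀q : ¬ i ≺ q
        i⊀q i≺q = only-edge-into i≺q λ i⊀q _ _ → i⊀q i≺q

  -- Edges common to two efficient vectors.

  module _ {n} {A C : Matrix n} (pcA : PC A) (pcC : PC C) (consistent : Consistent C)
           {u v : Vector Carrier n} (u∈ℰ : Efficient A u) (v∈ℰ : Efficient A v) where

    -- Connectivity of each graph separately would not suffice: paths must use edges that survive in
    -- convex combinations.
    CommonEdge : Rel (Fin n) ℓ
    CommonEdge i j = Edge A u i j × Edge A v i j

    ordered⇒connected :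
      ∀ {p q} → p ≢ q → (∃[ k ] k ≢ p × k ≢ q) →
      (∀ i j → (i , j) ≢ (p , q) → (i , j) ≢ (q , p) → A i j ≈ C i j) →
      C p q ≤ A p q → ∀ i j → Star CommonEdge i j
    ordered⇒connected p≢q third A≈C C≤A = cycle-through⇒connected third
      (efficient⇒edge-qp pcA u∈ℰ pcC consistent p≢q A≈C C≤A ,
       efficient⇒edge-qp pcA v∈ℰ pcC consistent p≢q A≈C C≤A)
      λ i i≢p i≢q → zip _,_ _,_
        (efficient⇒edges-through pcA u∈ℰ pcC consistent p≢q A≈C C≤A i i≢p i≢q)
        (efficient⇒edges-through pcA v∈ℰ pcC consistent p≢q A≈C C≤A i i≢p i≢q)

    connected : ∀ {p q} → p ≢ q →
                (∀ i j → (i , j) ≢ (p , q) → (i , j) ≢ (q , p) → A i j ≈ C i j) →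
                ¬ ¬ (∀ i j → Star CommonEdge i j)
    connected {p} {q} p≢q A≈C none with any? (λ k → ¬? (k ≟ p) ×-dec ¬? (k ≟ q))
    ... | no only = none (two-cycle⇒connected only
        (efficient⇒edge pcA u∈ℰ p≢q only , efficient⇒edge pcA v∈ℰ p≢q only)
        (efficient⇒edge pcA u∈ℰ q≢p only′ , efficient⇒edge pcA v∈ℰ q≢p only′))
      where
      q≢p : q ≢ p
      q≢p q≡p = p≢q (sym q≡p)

      only′ : ¬ (∃[ k ] k ≢ q × k ≢ p)
      only′ (k , k≢q , k≢p) = only (k , k≢p , k≢q)
    ... | yes (k , k≢p , k≢q) = ¬¬-excluded-middle λ where
      (no C≤A)  → none (ordered⇒connected p≢q (k , k≢p , k≢q) A≈C C≤A)
      -- Reciprocity turns `A p q < C p q` into `C q p ≤ A q p`, so `p` and `q` exchange roles.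
      (yes A<C) → none (ordered⇒connected (p≢q ∘ sym) (k , k≢q , k≢p)
        (λ i j ij≢qp ij≢pq → A≈C i j ij≢pq ij≢qp)
        (PC-antitone pcA pcC (<-asym A<C)))


theorem17 : ∀ {c ℓ} (ℝ : RealNumbers c ℓ) → let open PairwiseComparison ℝ in
    (n : ℕ) (A : Matrix n) → PC A → SimplePerturbedConsistent A → Convex (ℰ A)
theorem17 ℝ n A pcA (_ , C , pcC , consistent , p , q , p≢q , A≈C) {u} {v} u∈ℰ v∈ℰ t 0≤t t≤1 =
  connected⇒efficient ℝ p
    (λ i → convex-pos (positive u∈ℰ i) (positive v∈ℰ i) 0≤t t≤1)
    λ none → connected ℝ pcA pcC consistent u∈ℰ v∈ℰ p≢q A≈C λ common →
      none λ i j → map (Edge-convex ℝ {A = A} {u} {v} 0≤t t≤1) (common i j)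
  where
  open OrderedField ℝ using (convex-pos)
  open PairwiseComparison.Efficient using (positive)
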